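{- Let $M$ be a relational Fraïssé structure with strong amalgamation. Then the following are equivalent: (i) $M$ has the infinite sunflower property; (ii) $M$ has the infinite $2$-sunflower property; (iii) $M$ has the canonical infinite point-Ramsey property.
   Context: A Fraïssé structure is a countably infinite ultrahomogeneous first-order structure (each isomorphism between finitely generated substructures extends to an automorphism); it is relational if its language is relational. The age $\mathrm{Age}(M)$ is the class of finite structures embeddable in $M$. $M$ has strong amalgamation if for all pairs of embeddings $B_0 \leftarrow A \rightarrow B_1$ in $\mathrm{Age}(M)$ there is an amalgam $B_0 \rightarrow C \leftarrow B_1$ in $\mathrm{Age}(M)$ (the two composite embeddings $A \to C$ agree) such that the images of $B_0$ and $B_1$ in $C$ intersect exactly in the image of $A$. A copy of $M$ in a structure is a substructure isomorphic to $M$. For $k \in \mathbb{N}_+$, a $k$-set is a set of size $k$. A structure on $k$-sets is a first-order structure each element of whose domain is a $k$-set. A structure $S$ on $k$-sets is a structured sunflower if there is a set $c$ with $v \cap v' = c$ for all distinct $v, v' \in S$. An infinite structure $M$ has the infinite $k$-sunflower property if each structure on $k$-sets $M'$ with $M' \cong M$ contains (as a substructure) a structured sunflower $S \cong M$. $M$ has the infinite sunflower property if it has the infinite $k$-sunflower property for all $k \in \mathbb{N}_+$. $M$ has the canonical infinite point-Ramsey property if for each colouring $\chi : M \to \omega$ of the elements of $M$ there is a copy of $M$ in $M$ which is monochromatic (all elements have the same colour) or heterochromatic (all elements have pairwise different colours). -}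

module Defs where

open import Data.Fin.Base using (Fin)
open import Data.List.Base using (List)
import Data.List.Membership.Setoid as ListMembership
open import Data.Nat.Base using (ℕ; NonZero)
open import Data.Product.Base using (Σ; Σ-syntax; ∃; ∃-syntax; _×_; _,_; proj₁; proj₂)
open import Data.Sum.Base using (_⊎_)
open import Data.Vec.Base using (Vec)
open import Data.Vec.Functional using (Vector)
open import Data.Vec.Functional.Relation.Binary.Pointwise using (Pointwise)
open import Data.Vec.Membership.Propositional using (_∈_)
open import Data.Vec.Relation.Unary.Unique.Propositional using (Unique)
open import Function.Base using (_∘_)
open import Function.Bundles using (Func; Injection; Inverse; _⇔_)
open import Level using (0ℓ)
open import Relation.Binary.Bundles using (Setoid)
import Relation.Binary.Construct.On as On
open import Relation.Binary.Definitions using (_Respects_)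
open import Relation.Binary.PropositionalEquality using (_≡_; _≢_; setoid)
open import Relation.Nullary.Negation using (¬_)
open import Relation.Unary using (Pred; _∩_; _≐_)
open import Relation.Unary.Relation.Binary.Equality using (≐-setoid)

-- Sets are setoids throughout: k-sets carry extensional equality, and two
-- elements of a subset are equal when they are equal in the ambient set.

record Subset (A : Setoid 0ℓ 0ℓ) : Set₁ where
  open Setoid A
  field
    member : Pred Carrier 0ℓ
    resp   : member Respects _≈_

open Subset public

subsetoid : (A : Setoid 0ℓ 0ℓ) → Subset A → Setoid 0ℓ 0ℓ
subsetoid A P = On.setoid {B = Σ (Setoid.Carrier A) (member P)} A proj₁

inclusion : (A : Setoid 0ℓ 0ℓ) (P : Subset A) → Func (subsetoid A P) A
inclusion A P = record { to = proj₁ ; cong = λ e → e }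

record Language : Set₁ where
  field
    Symbol : Set
    arity  : Symbol → ℕ

open Language public

record Interpretation (L : Language) (A : Setoid 0ℓ 0ℓ) : Set₁ where
  open Setoid A
  field
    rel  : (R : Symbol L) → Pred (Vector Carrier (arity L R)) 0ℓ
    resp : (R : Symbol L) → rel R Respects Pointwise _≈_

pullback : {L : Language} {A B : Setoid 0ℓ 0ℓ} →
           Func A B → Interpretation L B → Interpretation L A
pullback f I = record
  { rel  = λ R xs → Interpretation.rel I R (Func.to f ∘ xs)
  ; resp = λ R e → Interpretation.resp I R (λ i → Func.cong f (e i))
  }

record Structure (L : Language) : Set₁ where
  field
    domain         : Setoid 0ℓ 0ℓ
    interpretation : Interpretation L domain
  open Setoid domain public using (Carrier; _≈_)
  open Interpretation interpretation public using (rel)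

module _ {L : Language} where

  open Structure using (domain; interpretation; rel)

  ∣_∣ : Structure L → Set
  ∣ M ∣ = Structure.Carrier M

  infix 30 _↾_
  infix 4 _≅_ _↪_

  -- The induced substructure; as L is relational, every subset carries one.
  _↾_ : (M : Structure L) → Subset (domain M) → Structure L
  M ↾ P = record
    { domain         = subsetoid (domain M) P
    ; interpretation = pullback (inclusion (domain M) P) (interpretation M)
    }

  record _↪_ (M N : Structure L) : Set where
    field
      injection : Injection (domain M) (domain N)
    open Injection injection public using (to; cong; injective)
    field
      preserves : (R : Symbol L) (xs : Vector ∣ M ∣ (arity L R)) →
                  rel M R xs ⇔ rel N R (to ∘ xs)

  record _≅_ (M N : Structure L) : Set where
    field
      inverse : Inverse (domain M) (domain N)
    open Inverse inverse public using (to; from; to-cong; from-cong; inverseˡ; inverseʳ)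
    field
      preserves : (R : Symbol L) (xs : Vector ∣ M ∣ (arity L R)) →
                  rel M R xs ⇔ rel N R (to ∘ xs)

  CountablyInfinite : Structure L → Set
  CountablyInfinite M = Inverse (domain M) (setoid ℕ)

  Finite : Structure L → Set
  Finite M = ∃[ n ] Inverse (domain M) (setoid (Fin n))

  -- In a relational language, the substructure generated by a set is that
  -- set itself, possibly empty.
  FinitelyGenerated : (M : Structure L) → Subset (domain M) → Set
  FinitelyGenerated M P = Σ[ xs ∈ List ∣ M ∣ ] (member P ≐ (M∈ xs))
    where
    open ListMembership (domain M) renaming (_∈_ to _∈ᴸ_)
    M∈ : List ∣ M ∣ → Pred ∣ M ∣ 0ℓ
    M∈ xs x = x ∈ᴸ xs

  Ultrahomogeneous : Structure L → Set₁
  Ultrahomogeneous M =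
    (P Q : Subset (domain M)) → FinitelyGenerated M P → FinitelyGenerated M Q →
    (f : M ↾ P ≅ M ↾ Q) →
    Σ[ g ∈ M ≅ M ] ((x : ∣ M ↾ P ∣) → _≅_.to g (proj₁ x) ≈ proj₁ (_≅_.to f x))
    where open Structure M using (_≈_)

  record IsFraïssé (M : Structure L) : Set₁ where
    field
      countablyInfinite : CountablyInfinite M
      ultrahomogeneous  : Ultrahomogeneous M

  Age : Structure L → Pred (Structure L) 0ℓ
  Age M A = Finite A × (A ↪ M)

  Image : {A B : Structure L} → (∣ A ∣ → ∣ B ∣) → Pred ∣ B ∣ 0ℓ
  Image {A} {B} f b = Σ[ a ∈ ∣ A ∣ ] Structure._≈_ B (f a) b

  record StrongAmalgam (M : Structure L) {A B₀ B₁ : Structure L}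
                       (e₀ : A ↪ B₀) (e₁ : A ↪ B₁) : Set₁ where
    field
      C      : Structure L
      C∈Age  : Age M C
      f₀     : B₀ ↪ C
      f₁     : B₁ ↪ C
    open _↪_ using (to)
    field
      commutes : (a : ∣ A ∣) →
                 Structure._≈_ C (to f₀ (to e₀ a)) (to f₁ (to e₁ a))
      strong   : (Image {B₀} {C} (to f₀) ∩ Image {B₁} {C} (to f₁))
                 ≐ Image {A} {C} (to f₀ ∘ to e₀)

  StrongAmalgamation : Structure L → Set₁
  StrongAmalgamation M =
    (A B₀ B₁ : Structure L) → Age M A → Age M B₀ → Age M B₁ →
    (e₀ : A ↪ B₀) (e₁ : A ↪ B₁) → StrongAmalgam M e₀ e₁

-- A k-set is a repetition-free k-tuple, considered up to having the same
-- elements.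
elements : {U : Set} {k : ℕ} → Σ (Vec U k) Unique → Pred U 0ℓ
elements (v , _) u = u ∈ v

KSet : ℕ → Set → Setoid 0ℓ 0ℓ
KSet k U = On.setoid {B = Σ (Vec U k) Unique} (≐-setoid U 0ℓ) elements

record KSetStructure (L : Language) (k : ℕ) : Set₁ where
  field
    U              : Set
    kSets          : Subset (KSet k U)
    interpretation : Interpretation L (subsetoid (KSet k U) kSets)

  structure : Structure L
  structure = record
    { domain = subsetoid (KSet k U) kSets ; interpretation = interpretation }

  underlying : ∣ structure ∣ → Pred U 0ℓ
  underlying v = elements (proj₁ v)

module _ {L : Language} where

  open Structure using (domain)
  open KSetStructure using (structure)

  infix 30 _↾ᴷ_

  -- The substructure of S induced on P, repackaged with its domain as a subset of KSet k U.
  _↾ᴷ_ : {k : ℕ} (S : KSetStructure L k) →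
         Subset (domain (structure S)) → KSetStructure L k
  _↾ᴷ_ {k} S P = record
    { U              = U
    ; kSets          = kSets′
    ; interpretation = pullback
        {A = subsetoid (KSet k U) kSets′}
        {B = subsetoid (KSet k U) kSets}
        (record { to = λ (v , p , _) → v , p ; cong = λ e → e })
        interpretation
    }
    where
    open KSetStructure S using (U; kSets; interpretation)
    kSets′ : Subset (KSet k U)
    kSets′ = record
      { member = λ v → Σ[ p ∈ member kSets v ] member P (v , p)
      ; resp   = λ e (p , q) → resp kSets e p , resp P e q
      }

  StructuredSunflower : {k : ℕ} → KSetStructure L k → Set₁
  StructuredSunflower S =
    Σ[ c ∈ Pred U 0ℓ ]
      ((v v′ : Carrier) → ¬ (v ≈ v′) → (underlying v ∩ underlying v′) ≐ c)
    where
    open KSetStructure S using (U; underlying)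
    open Structure (structure S) using (Carrier; _≈_)

  InfiniteKSunflowerProperty : ℕ → Structure L → Set₁
  InfiniteKSunflowerProperty k M =
    (M′ : KSetStructure L k) → structure M′ ≅ M →
    Σ[ P ∈ Subset (domain (structure M′)) ]
      (StructuredSunflower (M′ ↾ᴷ P) × structure (M′ ↾ᴷ P) ≅ M)

  InfiniteSunflowerProperty : Structure L → Set₁
  InfiniteSunflowerProperty M =
    (k : ℕ) → .{{NonZero k}} → InfiniteKSunflowerProperty k M

  Colouring : Structure L → Set
  Colouring M = Func (domain M) (setoid ℕ)

  Monochromatic : (M : Structure L) → Colouring M → Subset (domain M) → Set
  Monochromatic M χ P =
    (x y : ∣ M ∣) → member P x → member P y → Func.to χ x ≡ Func.to χ y

  Heterochromatic : (M : Structure L) → Colouring M → Subset (domain M) → Set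
  Heterochromatic M χ P =
    (x y : ∣ M ∣) → member P x → member P y →
    ¬ (Structure._≈_ M x y) → Func.to χ x ≢ Func.to χ y

  CanonicalInfinitePointRamsey : Structure L → Set₁
  CanonicalInfinitePointRamsey M =
    (χ : Colouring M) →
    Σ[ P ∈ Subset (domain M) ]
      ((M ↾ P ≅ M) × (Monochromatic M χ P ⊎ Heterochromatic M χ P))

{-# OPTIONS --safe #-}
-- (ii) ⇒ (iii): a colouring χ is coded by the 2-sets {x, χ(x)}, points and
-- colours being kept disjoint.  The centre of a sunflower of such 2-sets is
-- empty, so that all colours differ, or contains a colour shared by all points.
--
-- (iii) ⇒ (i): listing each k-set as a k-tuple gives k colourings, so some copy
-- has each coordinate either constant or injective.  Two tuples s(x), s(y) can
-- then meet outside the constant coordinates only if sᵢ(x) = sⱼ(y) for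
-- injective coordinates i, j.  When y < x in an enumeration of M, this y is a
-- function of x, so the graph of such pairs is a forest and has a 2-colouring;
-- two colours cannot be heterochromatic, so a further copy has no such pair.
module Submission where

open import Defs
open import Axiom.ExcludedMiddle using (ExcludedMiddle)
open import Data.Bool.Base using (Bool; true; false; not)
open import Data.Bool.Properties using (not-¬)
open import Data.Empty using (⊥-elim)
open import Data.Fin.Base using (Fin; zero; suc; combine; remQuot)
open import Data.Fin.Properties using (remQuot-combine)
open import Data.Nat.Base using (ℕ; zero; suc; _*_; _<_; _≤_)
open import Data.Nat.Induction using (<-rec; <-wellFounded)
open import Data.Nat.Properties using (≤-antisym; ≮⇒≥; <-cmp; _≟_)
open import Data.Product.Base using (Σ-syntax; ∃-syntax; _×_; _,_; proj₁; proj₂; uncurry)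
open import Data.Sum.Base using (_⊎_; inj₁; inj₂) renaming (map to map⊎)
open import Data.Sum.Properties using (inj₁-injective; inj₂-injective)
open import Data.Vec.Base using (Vec; []; _∷_; lookup)
open import Data.Vec.Membership.Propositional using (_∈_)
open import Data.Vec.Membership.Propositional.Properties using (∈-lookup)
open import Data.Vec.Relation.Unary.All using ([]; _∷_)
open import Data.Vec.Relation.Unary.AllPairs using ([]; _∷_)
open import Data.Vec.Relation.Unary.Any using (here; there; index)
open import Data.Vec.Relation.Unary.Any.Properties using (lookup-index)
open import Data.Vec.Relation.Unary.Unique.Propositional using (Unique)
open import Function.Base using (_∘_; id)
open import Function.Bundles using (Func; Inverse; _⇔_; mk⇔; Equivalence)
import Function.Construct.Composition as Composition
open import Function.Definitions using (Injective)
open import Function.Properties.Inverse using (Inverse⇒Injection)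
open import Induction.WellFounded using (WfRec; module FixPoint)
open import Level using (0ℓ)
open import Relation.Binary.Bundles using (Setoid)
open import Relation.Binary.Core using (Rel)
open import Relation.Binary.Definitions using (tri<; tri≈; tri>)
open import Relation.Binary.PropositionalEquality
  using (_≡_; _≢_; _≗_; refl; sym; trans; cong; subst)
open import Relation.Nullary.Decidable.Core using (yes; no; decidable-stable)
open import Relation.Nullary.Negation using (¬_; contradiction)
open import Relation.Unary using (Pred; _≐_)
open import Relation.Unary.Properties using (≐-sym; ≐-trans)

-- Constant and injective colourings.

Constant : {A B : Set} → (A → B) → Set
Constant h = ∀ x y → h x ≡ h y

Canonical : {A B : Set} → (A → B) → Set
Canonical h = Constant h ⊎ Injective _≡_ _≡_ h

Canonical-∘ : {A B C : Set} {h : B → C} {g : A → B} →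
              Injective _≡_ _≡_ g → Canonical h → Canonical (h ∘ g)
Canonical-∘ g-inj = map⊎ (λ con _ _ → con _ _) (λ inj → g-inj ∘ inj)

¬ℕ↣Bool : (h : ℕ → Bool) → ¬ Injective _≡_ _≡_ h
¬ℕ↣Bool h inj with h 0 in p | h 1 in q | h 2 in r
... | false | false | _     = contradiction (inj (trans p (sym q))) λ ()
... | false | true  | false = contradiction (inj (trans p (sym r))) λ ()
... | false | true  | true  = contradiction (inj (trans q (sym r))) λ ()
... | true  | true  | _     = contradiction (inj (trans p (sym q))) λ ()
... | true  | false | true  = contradiction (inj (trans p (sym r))) λ ()
... | true  | false | false = contradiction (inj (trans q (sym r))) λ ()

-- For two colours the heterochromatic outcome is impossible, so the canonical Ramsey property
-- reduces to indivisibility.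
canonical-Bool⇒constant : {h : ℕ → Bool} → Canonical h → Constant h
canonical-Bool⇒constant (inj₁ con) = con
canonical-Bool⇒constant (inj₂ inj) = ⊥-elim (¬ℕ↣Bool _ inj)

module _ (em : ExcludedMiddle 0ℓ) where

  least : (P : Pred ℕ 0ℓ) (n : ℕ) → P n →
          ∃[ m ] P m × (∀ i → P i → m ≤ i)
  least P = <-rec _ step
    where
    step : ∀ n → (∀ {i} → i < n → P i → ∃[ m ] P m × (∀ j → P j → m ≤ j)) →
           P n → ∃[ m ] P m × (∀ j → P j → m ≤ j)
    step n rec Pn with em {∃[ i ] i < n × P i}
    ... | yes (i , i<n , Pi) = rec i<n Pi
    ... | no none = n , Pn , λ j Pj → ≮⇒≥ λ j<n → none (j , j<n , Pj)

  -- The Ramsey hypothesis takes colours in ℕ, while coordinates of k-sets lie in an arbitrary `U`.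
  -- Naming each value of `h` by the least index where it occurs keeps the same colour classes.
  naturalColours : {U : Set} (h : ℕ → U) →
                   Σ[ χ ∈ (ℕ → ℕ) ] (∀ x y → χ x ≡ χ y ⇔ h x ≡ h y)
  naturalColours h = χ , λ x y → mk⇔
    (λ e → trans (sym (h∘χ x)) (trans (cong h e) (h∘χ y)))
    (λ e → ≤-antisym (χ-min x (trans (h∘χ y) (sym e))) (χ-min y (trans (h∘χ x) e)))
    where
    first : ∀ x → ∃[ m ] h m ≡ h x × (∀ i → h i ≡ h x → m ≤ i)
    first x = least (λ m → h m ≡ h x) x refl
    χ : ℕ → ℕ
    χ x = proj₁ (first x)
    h∘χ : ∀ x → h (χ x) ≡ h x
    h∘χ x = proj₁ (proj₂ (first x))
    χ-min : ∀ x {i} → h i ≡ h x → χ x ≤ i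
    χ-min x = proj₂ (proj₂ (first x)) _

  -- Two-colouring a forest on ℕ.

  module _ (R : Rel ℕ 0ℓ) where

    private
      Parent : ℕ → Set
      Parent x = ∃[ y ] y < x × R x y

      -- A point takes the colour opposite to that of a chosen smaller neighbour; the roots get
      -- `false`.
      step : ∀ x → WfRec _<_ (λ _ → Bool) x → Bool
      step x rec with em {Parent x}
      ... | yes (y , y<x , _) = not (rec y<x)
      ... | no  _             = false

      -- `unfold-wfRec` asks that `step` depend on its recursive argument only pointwise.
      step-ext : ∀ x {r r′ : WfRec _<_ (λ _ → Bool) x} →
                 (∀ {y} (y<x : y < x) → r y<x ≡ r′ y<x) → step x r ≡ step x r′
      step-ext x r≡r′ with em {Parent x}
      ... | yes (y , y<x , _) = cong not (r≡r′ y<x)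
      ... | no  _             = refl

    twoColouring : ℕ → Bool
    twoColouring = <-rec (λ _ → Bool) step

    twoColouring-proper : (∀ {x y y′} → R x y → R x y′ → y ≡ y′) →
                          ∀ {x y} → y < x → R x y →
                          twoColouring x ≡ not (twoColouring y)
    twoColouring-proper functional {x} {y} y<x Rxy =
      trans (FixPoint.unfold-wfRec <-wellFounded _ step step-ext) step-parent
      where
      step-parent : step x (λ {z} _ → twoColouring z) ≡ not (twoColouring y)
      step-parent with em {Parent x}
      -- The parent `z` chosen by `em` might differ from `y`; functionality of `R` identifies them.
      ... | yes (z , _ , Rxz) = cong (not ∘ twoColouring) (functional Rxz Rxy)
      ... | no  none          = contradiction (y , y<x , Rxy) none

  -- Sunflowers from the canonical Ramsey property.

  -- 𝓔 abstracts the self-embeddings of a structure enumerated by ℕ.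
  module CanonicalRamsey
    (𝓔 : Pred (ℕ → ℕ) 0ℓ) (id∈𝓔 : 𝓔 id)
    (∘-closed : ∀ {f g} → 𝓔 f → 𝓔 g → 𝓔 (f ∘ g))
    (𝓔⇒injective : ∀ {f} → 𝓔 f → Injective _≡_ _≡_ f)
    (ramsey : (χ : ℕ → ℕ) → ∃[ f ] 𝓔 f × Canonical (χ ∘ f))
    where

    canonise : {U : Set} (h : ℕ → U) → ∃[ f ] 𝓔 f × Canonical (h ∘ f)
    canonise h with naturalColours h
    ... | χ , χ⇔h with ramsey χ
    ... | f , f∈𝓔 , can = f , f∈𝓔 , map⊎
      (λ con x y → Equivalence.to (χ⇔h _ _) (con x y))
      (λ inj e → inj (Equivalence.from (χ⇔h _ _) e)) can

    -- The colourings are treated one after another: passing to a further copy along the injective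
    -- `g` keeps the earlier ones canonical.
    canoniseAll : {U : Set} (n : ℕ) (h : Fin n → ℕ → U) →
                  ∃[ f ] 𝓔 f × (∀ i → Canonical (h i ∘ f))
    canoniseAll zero h = id , id∈𝓔 , λ ()
    canoniseAll (suc n) h with canonise (h zero)
    ... | f , f∈𝓔 , can₀ with canoniseAll n (λ i → h (suc i) ∘ f)
    ... | g , g∈𝓔 , can = f ∘ g , ∘-closed f∈𝓔 g∈𝓔 , λ where
      zero    → Canonical-∘ (𝓔⇒injective g∈𝓔) can₀
      (suc i) → can i

    -- The conclusion names no centre: it can be recovered as the set of elements common to all
    -- tuples.
    sunflower : {U : Set} {k : ℕ} (s : ℕ → Vec U k) →
                ∃[ f ] 𝓔 f × (∀ {x y u} → x ≢ y → u ∈ s (f x) → u ∈ s (f y) →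
                              ∀ z → u ∈ s (f z))
    sunflower {U} {k} s with canoniseAll k (λ i x → lookup (s x) i)
    -- One `Bool`-colouring for each ordered pair of coordinates, with pairs numbered by
    -- `Fin (k * k)`; all of them are made constant by a second copy `g`.
    ... | f , f∈𝓔 , canonical = conclude (canoniseAll (k * k) (uncurry colour ∘ remQuot k))
      where
      t : Fin k → ℕ → U
      t i x = lookup (s (f x)) i

      colour : Fin k → Fin k → ℕ → Bool
      colour i j = twoColouring (λ x y → t i x ≡ t j y)

      conclude : ∃[ g ] 𝓔 g × (∀ p → Canonical (uncurry colour (remQuot k p) ∘ g)) →
                 ∃[ e ] 𝓔 e × (∀ {x y u} → x ≢ y → u ∈ s (e x) → u ∈ s (e y) →
                               ∀ z → u ∈ s (e z))
      conclude (g , g∈𝓔 , canonical′) = f ∘ g , ∘-closed f∈𝓔 g∈𝓔 , λ x≢y u∈x u∈y →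
        common x≢y (index u∈x) (index u∈y) (lookup-index u∈x) (lookup-index u∈y)
        where
        monochromatic : ∀ i j → Constant (colour i j ∘ g)
        monochromatic i j = canonical-Bool⇒constant
          (subst (λ p → Canonical (uncurry colour p ∘ g)) (remQuot-combine i j)
            (canonical′ (combine i j)))

        -- Injectivity of `t j` makes the smaller point a function of the larger, so the 2-colouring
        -- is proper. The equation would be an edge with ends of opposite colours, yet the colouring
        -- is constant along `g`.
        disjoint : ∀ i j → Injective _≡_ _≡_ (t j) →
                   ∀ {x y} → g y < g x → t i (g x) ≢ t j (g y)
        disjoint i j inj {x} {y} gy<gx e = not-¬ (monochromatic i j x y)
          (twoColouring-proper _ (λ p q → inj (trans (sym p) q)) gy<gx e)

        constant⇒∈ : ∀ {i x u} → Constant (t i) → u ≡ t i x → ∀ z → u ∈ s (f z)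
        constant⇒∈ {i} con u≡ z =
          subst (_∈ s (f z)) (trans (con z _) (sym u≡)) (∈-lookup i (s (f z)))

        common : ∀ {x y u} → x ≢ y → ∀ i j → u ≡ t i (g x) → u ≡ t j (g y) →
                 ∀ z → u ∈ s (f (g z))
        common {x} {y} x≢y i j u≡x u≡y with canonical i | canonical j
        ... | inj₁ con | _        = constant⇒∈ con u≡x ∘ g
        ... | inj₂ _   | inj₁ con = constant⇒∈ con u≡y ∘ g
        -- Edges run from the larger point to the smaller, so the order of `g x` and `g y` decides
        -- between the pairs `(i, j)` and `(j, i)`.
        ... | inj₂ inj | inj₂ inj′ with <-cmp (g x) (g y)
        ...   | tri< gx<gy _ _ =
          contradiction (trans (sym u≡y) u≡x) (disjoint j i inj gx<gy)
        ...   | tri≈ _ gx≡gy _ = contradiction (𝓔⇒injective g∈𝓔 gx≡gy) x≢y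
        ...   | tri> _ _ gy<gx =
          contradiction (trans (sym u≡x) u≡y) (disjoint i j inj′ gy<gx)

-- Embeddings and isomorphisms of relational structures.

module _ {L : Language} where

  open Structure using (domain)

  ↪-refl : {M : Structure L} → M ↪ M
  ↪-refl = record
    { injection = record { to = id ; cong = id ; injective = id }
    ; preserves = λ _ _ → mk⇔ id id
    }

  ↪-trans : {M N O : Structure L} → M ↪ N → N ↪ O → M ↪ O
  ↪-trans e f = record
    { injection = Composition.injection (_↪_.injection e) (_↪_.injection f)
    ; preserves = λ R xs → Composition.equivalence
        (_↪_.preserves e R xs) (_↪_.preserves f R (_↪_.to e ∘ xs))
    }

  ≅-trans : {M N O : Structure L} → M ≅ N → N ≅ O → M ≅ O
  ≅-trans e f = record
    { inverse   = Composition.inverse (_≅_.inverse e) (_≅_.inverse f)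
    ; preserves = λ R xs → Composition.equivalence
        (_≅_.preserves e R xs) (_≅_.preserves f R (_≅_.to e ∘ xs))
    }

  ≅-sym : {M N : Structure L} → M ≅ N → N ≅ M
  ≅-sym {M} {N} e = record
    { inverse = record
      { to = from ; from = to ; to-cong = from-cong ; from-cong = to-cong
      ; inverse = inverseʳ , inverseˡ
      }
    ; preserves = λ R ys → mk⇔
        (λ r → Equivalence.from (preserves R (from ∘ ys))
          (resp-N R (λ i → N.sym (inverseˡ M.refl)) r))
        (λ r → resp-N R (λ i → inverseˡ M.refl)
          (Equivalence.to (preserves R (from ∘ ys)) r))
    }
    where
    open _≅_ e
    module M = Setoid (domain M)
    module N = Setoid (domain N)
    open Interpretation (Structure.interpretation N) renaming (resp to resp-N)

  ≅⇒↪ : {M N : Structure L} → M ≅ N → M ↪ N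
  ≅⇒↪ e = record
    { injection = Inverse⇒Injection (_≅_.inverse e) ; preserves = _≅_.preserves e }

  ↾⇒↪ : (M : Structure L) (P : Subset (domain M)) → M ↾ P ↪ M
  ↾⇒↪ M P = record
    { injection = record { to = proj₁ ; cong = id ; injective = id }
    ; preserves = λ _ _ → mk⇔ id id
    }

  image : {M N : Structure L} → M ↪ N → Subset (domain N)
  image {M} {N} e = record
    { member = Image {A = M} {B = N} (_↪_.to e)
    ; resp   = λ y≈z (x , ex≈y) → x , Setoid.trans (domain N) ex≈y y≈z
    }

  image-≅ : {M N : Structure L} (e : M ↪ N) → N ↾ image e ≅ M
  image-≅ {M} {N} e = record
    { inverse = record
      { to        = λ (_ , x , _) → x
      ; from      = λ x → to x , x , N.refl
      ; to-cong   = λ {(_ , _ , p)} {(_ , _ , q)} y≈z →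
                      injective (N.trans p (N.trans y≈z (N.sym q)))
      ; from-cong = e-cong
      ; inverse   = (λ {_} {(_ , _ , q)} y≈ → injective (N.trans q y≈))
                  , (λ {(_ , _ , q)} x≈ → N.trans (e-cong x≈) q)
      }
    ; preserves = λ R ys → mk⇔
        (λ r → Equivalence.from (preserves R _)
          (resp-N R (λ i → N.sym (proj₂ (proj₂ (ys i)))) r))
        (λ r → resp-N R (λ i → proj₂ (proj₂ (ys i)))
          (Equivalence.to (preserves R _) r))
    }
    where
    open _↪_ e renaming (cong to e-cong)
    module N = Setoid (domain N)
    open Interpretation (Structure.interpretation N) renaming (resp to resp-N)

  ↾ᴷ-≅ : {k : ℕ} (S : KSetStructure L k) (P : Subset (domain (KSetStructure.structure S))) →
         KSetStructure.structure (S ↾ᴷ P) ≅ KSetStructure.structure S ↾ P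
  ↾ᴷ-≅ S P = record
    { inverse = record
      { to        = λ (v , p , q) → (v , p) , q
      ; from      = λ ((v , p) , q) → v , p , q
      ; to-cong   = id
      ; from-cong = id
      ; inverse   = id , id
      }
    ; preserves = λ _ _ → mk⇔ id id
    }

  module _ (em : ExcludedMiddle 0ℓ) (M : Structure L) (M≃ℕ : CountablyInfinite M) where

    private
      module M = Setoid (domain M)
      open Inverse M≃ℕ using ()
        renaming (to to code; from to decode; to-cong to code-cong; from-cong to decode-cong)

      code-decode : ∀ n → code (decode n) ≡ n
      code-decode n = Inverse.inverseˡ M≃ℕ M.refl

      decode-code : ∀ x → decode (code x) M.≈ x
      decode-code x = Inverse.inverseʳ M≃ℕ refl

      code-injective : ∀ {x y} → code x ≡ code y → x M.≈ y
      code-injective e =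
        M.trans (M.sym (decode-code _)) (M.trans (decode-cong e) (decode-code _))

      decode-injective : ∀ {m n} → decode m M.≈ decode n → m ≡ n
      decode-injective e = trans (sym (code-decode _)) (trans (code-cong e) (code-decode _))

    -- From 2-sunflowers to the canonical point-Ramsey property.

    module _ (χ : Colouring M) where

      private
        χ′ : ℕ → ℕ
        χ′ = Func.to χ ∘ decode

        -- Points enter through their codes: membership in a k-set is propositional, while points of
        -- `M` are equal only up to `≈`.
        pair : ℕ → Σ[ v ∈ Vec (ℕ ⊎ ℕ) 2 ] Unique v
        pair n = inj₁ n ∷ inj₂ (χ′ n) ∷ [] , ((λ ()) ∷ []) ∷ [] ∷ []

        point∈ : ∀ {m n} → inj₁ m ∈ proj₁ (pair n) → m ≡ n
        point∈ (here e)         = inj₁-injective e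
        point∈ (there (here ()))

        colour∈ : ∀ {m n} → inj₂ m ∈ proj₁ (pair n) → m ≡ χ′ n
        colour∈ (there (here e)) = inj₂-injective e

        pair-injective : ∀ {m n} → elements (pair m) ≐ elements (pair n) → m ≡ n
        pair-injective (m⊆n , _) = point∈ (m⊆n (here refl))

      pairs : Subset (KSet 2 (ℕ ⊎ ℕ))
      pairs = record
        { member = λ v → ∃[ n ] elements (pair n) ≐ elements v
        ; resp   = λ v≐w (n , n≐v) → n , ≐-trans n≐v v≐w
        }

      -- The witness `n` is determined by the 2-set, whose only point is `inj₁ n`; hence it may be
      -- read off.
      pairs⟶M : Func (subsetoid (KSet 2 (ℕ ⊎ ℕ)) pairs) (domain M)
      pairs⟶M = record
        { to   = λ (_ , n , _) → decode n
        ; cong = λ {(_ , _ , p)} {(_ , _ , q)} v≐w →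
            decode-cong (pair-injective (≐-trans p (≐-trans v≐w (≐-sym q))))
        }

      pairStructure : KSetStructure L 2
      pairStructure = record
        { U = ℕ ⊎ ℕ ; kSets = pairs
        ; interpretation = pullback pairs⟶M (Structure.interpretation M)
        }

      pairStructure-≅ : KSetStructure.structure pairStructure ≅ M
      pairStructure-≅ = record
        { inverse = record
          { to        = Func.to pairs⟶M
          ; from      = λ x → pair (code x) , code x , ≐-refl
          ; to-cong   = λ {v} {w} → Func.cong pairs⟶M {v} {w}
          ; from-cong = λ x≈y → pair-cong (code-cong x≈y)
          ; inverse   = (λ {x} {(v , n , p)} v≐ → M.trans
                          (decode-cong (pair-injective (≐-trans p v≐))) (decode-code x))
                      , (λ {(v , n , p)} x≈n → ≐-trans
                          (pair-cong (trans (code-cong x≈n) (code-decode n))) p)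
          }
        ; preserves = λ _ _ → mk⇔ id id
        }
        where
        ≐-refl : ∀ {n} → elements (pair n) ≐ elements (pair n)
        ≐-refl = id , id
        pair-cong : ∀ {m n} → m ≡ n → elements (pair m) ≐ elements (pair n)
        pair-cong refl = ≐-refl

    2-sunflower⇒ramsey : InfiniteKSunflowerProperty 2 M → CanonicalInfinitePointRamsey M
    2-sunflower⇒ramsey sun χ with sun (pairStructure χ) (pairStructure-≅ χ)
    ... | P , (c , isSunflower) , S≅M = image e , image-≅ e , monoOrHetero
      where
      S = pairStructure χ ↾ᴷ P
      open KSetStructure S using (structure; underlying)
      open Structure structure using () renaming (_≈_ to _≈ˢ_)

      e : M ↪ M
      -- `M` is carried onto the sunflower, and each pair is then sent to its point.
      e = ↪-trans (≅⇒↪ (≅-trans (≅-sym S≅M) (↾ᴷ-≅ (pairStructure χ) P)))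
            (↪-trans (↾⇒↪ (KSetStructure.structure (pairStructure χ)) P)
              (≅⇒↪ (pairStructure-≅ χ)))
      open _↪_ e using (to) renaming (cong to to-cong)

      petal : ∣ M ∣ → ∣ structure ∣
      petal = _≅_.from S≅M

      petal-injective : ∀ {x y} → petal x ≈ˢ petal y → x M.≈ y
      petal-injective {x} {y} = _↪_.injective (≅⇒↪ (≅-sym S≅M)) {x} {y}

      hue : ∣ M ∣ → ℕ
      hue = Func.to χ ∘ to

      -- By unfolding, `to x` is the point of the pair `petal x`, and `hue x` is the colour in that
      -- pair.
      hue∈petal : ∀ x → underlying (petal x) (inj₂ (hue x))
      hue∈petal x = proj₁ (proj₂ (proj₁ (proj₂ (petal x)))) (there (here refl))

      ∈petal⇒hue : ∀ {m} x → underlying (petal x) (inj₂ m) → m ≡ hue x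
      ∈petal⇒hue x u∈ with proj₂ (proj₂ (proj₁ (proj₂ (petal x)))) u∈
      ... | there (here q) = inj₂-injective q

      hue-cong : ∀ {x y} → x M.≈ y → hue x ≡ hue y
      hue-cong x≈y = Func.cong χ (to-cong x≈y)

      -- One coincidence suffices: the shared colour lies in two petals, hence in the centre and so
      -- in any two distinct petals, each of which contains only one colour.
      monochromatic : ∀ {x y} → ¬ x M.≈ y → hue x ≡ hue y → Constant hue
      monochromatic {x} {y} x≉y q z w with em {z M.≈ w}
      ... | yes z≈w = hue-cong z≈w
      ... | no  z≉w = trans (sym (∈petal⇒hue z (proj₁ u∈))) (∈petal⇒hue w (proj₂ u∈))
        where
        u∈c : c (inj₂ (hue x))
        u∈c = proj₁ (isSunflower (petal x) (petal y) (x≉y ∘ petal-injective))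
          (hue∈petal x , subst (underlying (petal y) ∘ inj₂) (sym q) (hue∈petal y))
        u∈ = proj₂ (isSunflower (petal z) (petal w) (z≉w ∘ petal-injective)) u∈c

      monoOrHetero : Monochromatic M χ (image e) ⊎ Heterochromatic M χ (image e)
      monoOrHetero with em {∃[ x ] ∃[ y ] ¬ x M.≈ y × hue x ≡ hue y}
      ... | yes (_ , _ , x≉y , q) = inj₁ λ _ _ (x , ex≈) (y , ey≈) →
        trans (sym (Func.cong χ ex≈)) (trans (monochromatic x≉y q x y) (Func.cong χ ey≈))
      ... | no none = inj₂ λ _ _ (x , ex≈) (y , ey≈) ≉ q → none
        ( x , y
        , (λ x≈y → ≉ (M.trans (M.sym ex≈) (M.trans (to-cong x≈y) ey≈)))
        , trans (Func.cong χ ex≈) (trans q (sym (Func.cong χ ey≈))))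

    -- From the canonical point-Ramsey property to sunflowers.

    module _ (ramsey : CanonicalInfinitePointRamsey M) where

      private
        encode : M ↪ M → ℕ → ℕ
        encode e = code ∘ _↪_.to e ∘ decode

        -- Agreement with `encode e` is only pointwise, since `decode` and `code` cancel only up to
        -- an equality proof; this gives the identity and closure under composition.
        𝓔 : Pred (ℕ → ℕ) 0ℓ
        𝓔 f = Σ[ e ∈ M ↪ M ] f ≗ encode e

        𝓔⇒injective : ∀ {f} → 𝓔 f → Injective _≡_ _≡_ f
        𝓔⇒injective (e , f≗) q = decode-injective (_↪_.injective e
          (code-injective (trans (sym (f≗ _)) (trans q (f≗ _)))))

        𝓔-closed : ∀ {f g} → 𝓔 f → 𝓔 g → 𝓔 (f ∘ g)
        𝓔-closed (d , f≗) (e , g≗) = ↪-trans e d , λ n →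
          trans (f≗ _) (code-cong (_↪_.cong d (M.trans (decode-cong (g≗ n)) (decode-code _))))

        ℕ-ramsey : (χ : ℕ → ℕ) → ∃[ f ] 𝓔 f × Canonical (χ ∘ f)
        ℕ-ramsey χ with ramsey (record { to = χ ∘ code ; cong = cong χ ∘ code-cong })
        ... | P , P≅M , monoOrHetero = encode e , (e , λ _ → refl) , map⊎
          (λ mono x y → mono _ _ (member∘e x) (member∘e y))
          -- Heterochromaticity only separates distinct points; decidable equality on ℕ turns this
          -- into injectivity.
          (λ hetero {x} {y} q → decidable-stable (x ≟ y) λ x≢y →
            hetero _ _ (member∘e x) (member∘e y)
              (x≢y ∘ decode-injective ∘ _↪_.injective e) q)
          monoOrHetero
          where
          e = ↪-trans (≅⇒↪ (≅-sym P≅M)) (↾⇒↪ M P)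
          member∘e : ∀ n → member P (_↪_.to e (decode n))
          member∘e n = proj₂ (_≅_.from P≅M (decode n))

      ramsey⇒sunflower : InfiniteSunflowerProperty M
      ramsey⇒sunflower k M′ M′≅M
        with CanonicalRamsey.sunflower em 𝓔 (↪-refl , λ n → sym (code-decode n))
               𝓔-closed 𝓔⇒injective ℕ-ramsey s
        where
        -- A k-set has no preferred order; the representative returned at `decode n` fixes one
        -- listing for each index.
        s : ℕ → Vec (KSetStructure.U M′) k
        s n = proj₁ (proj₁ (_≅_.from M′≅M (decode n)))
      ... | f , (e , f≗) , core =
        image ε , (centre , isSunflower) , ≅-trans (↾ᴷ-≅ M′ (image ε)) (image-≅ ε)
        where
        open KSetStructure M′ using (U; structure; underlying)
        open Setoid (domain structure) using () renaming (sym to ≈-sym; trans to ≈-trans)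

        ε : M ↪ structure
        ε = ↪-trans e (≅⇒↪ (≅-sym M′≅M))

        petal : ℕ → Pred U 0ℓ
        petal n = underlying (_≅_.from M′≅M (decode (f n)))

        centre : Pred U 0ℓ
        centre u = ∀ n → petal n u

        -- The combinatorial argument indexes petals by ℕ through `f`, the copy by points through
        -- `ε`; they match as `f` is `e` read along the enumeration. The vectors may differ, but not
        -- the k-sets.
        ε≐petal : ∀ x → underlying (_↪_.to ε x) ≐ petal (code x)
        ε≐petal x = _≅_.from-cong M′≅M (M.sym (M.trans (decode-cong (f≗ _))
          (M.trans (decode-code _) (_↪_.cong e (decode-code x)))))

        isSunflower : (v v′ : ∣ KSetStructure.structure (M′ ↾ᴷ image ε) ∣) → _
        isSunflower (v , p , x , εx≈v) (v′ , p′ , y , εy≈v′) v≉v′ =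
          (λ (u∈v , u∈v′) → core x≢y (proj₂ v≐ u∈v) (proj₂ v′≐ u∈v′)) ,
          (λ u∈c → proj₁ v≐ (u∈c (code x)) , proj₁ v′≐ (u∈c (code y)))
          where
          v≐ : petal (code x) ≐ elements v
          v≐ = ≐-trans (≐-sym (ε≐petal x)) εx≈v
          v′≐ : petal (code y) ≐ elements v′
          v′≐ = ≐-trans (≐-sym (ε≐petal y)) εy≈v′
          x≢y : code x ≢ code y
          x≢y q = v≉v′ (≐-trans (≐-sym v≐)
            (subst (λ n → petal n ≐ elements v′) (sym q) v′≐))

theoremA : ExcludedMiddle 0ℓ → (L : Language) (M : Structure L) → IsFraïssé M → StrongAmalgamation M →
    (InfiniteSunflowerProperty M ⇔ InfiniteKSunflowerProperty 2 M)
    × (InfiniteKSunflowerProperty 2 M ⇔ CanonicalInfinitePointRamsey M)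
theoremA em L M fraïssé _ =
  mk⇔ (λ sun → sun 2) (ramsey⇒sunflower em M M≃ℕ ∘ 2-sunflower⇒ramsey em M M≃ℕ) ,
  mk⇔ (2-sunflower⇒ramsey em M M≃ℕ) (λ ramsey → ramsey⇒sunflower em M M≃ℕ ramsey 2)
  where
  M≃ℕ = IsFraïssé.countablyInfinite fraïssé
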